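{- Let $n$ be a positive integer and let $\mathscr{A}=\langle A,\mathbf{R}\rangle$ be a boxes & connectors (B&C) architecture. Then $\mathscr{A}$ is an $n$-tier B&C architecture if and only if there exists a surjective homomorphism $h:\mathscr{A}\to\mathscr{T}_n$ to the elementary $n$-tier architecture $\mathscr{T}_n$.
   Context: An architecture is a triple $\mathscr{A} = \langle A, \mathbf{R}, \mathbf{F}\rangle$ where $A$ is a (possibly empty) set, called the universe; $\mathbf{R}$ is a countable set of relations over $A$, each $R\in\mathbf{R}$ being a subset of $A^{k}$ for some arity $k=\alpha(R)\in\mathbb{N}$; and $\mathbf{F}$ is a countable set of functions from subsets of powers $A^m$ to $A$. One writes $R(a_1,\dots,a_k)$ for $(a_1,\dots,a_k)\in R$. A boxes & connectors (B&C) architecture is an architecture with $\mathbf{R}\subseteq\mathcal{P}(A^2)$ (all relations are binary) and $\mathbf{F}=\emptyset$; it is written $\langle A,\mathbf{R}\rangle$. An architecture $\langle A,\mathbf{R},\mathbf{F}\rangle$ is an $n$-tier architecture if there is a partition $C=\{C_1,\dots,C_n\}$ of $A$ into $n$ (nonempty) pairwise disjoint sets such that for every $R\in\mathbf{R}$, with arity $k=\alpha(R)$, and all $a_1,\dots,a_k\in A$: if $R(a_1,\dots,a_k)$, then there exists $l$ with $1\le l<n$ such that for all $j=1,\dots,k$ one has $a_j\in C_l$ or $a_j\in C_{l+1}$. An $n$-tier B&C architecture is a B&C architecture that is an $n$-tier architecture. The elementary $n$-tier architecture is the B&C architecture $\mathscr{T}_n=\langle T_n,\{T^L\}\rangle$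 with $T_n=\{1,2,\dots,n\}$ and $T^L\subseteq T_n\times T_n$ the binary relation with $T^L(i,j)$ if $|i-j|\le 1$ and not $T^L(i,j)$ if $|i-j|>1$. A homomorphism between B&C architectures $\langle A,\mathbf{R}^A\rangle$ and $\langle B,\mathbf{R}^B\rangle$ is a pair $h=\langle h_0,h_R\rangle$ of maps $h_0:A\to B$ and $h_R:\mathbf{R}^A\to\mathbf{R}^B$ such that for every $R\in\mathbf{R}^A$ and $a_1,a_2\in A$: $R(a_1,a_2)\Rightarrow h_R(R)(h_0(a_1),h_0(a_2))$. (The general definition for architectures also has a map $h_F$ between the sets of functions, which is the empty map here.) It is called surjective if $h_0$ and $h_R$ (and the trivially surjective $h_F$) are all surjective.
   Formalization: "Only if" is stated for nonempty R (with R empty no map onto {T^L} exists, though an n-tier architecture may) and "if" for n ≥ 2 (by the definition a 1-tier architecture has only empty relations, so the elementary architecture T_1 itself is a counterexample). -}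

module Defs where

open import Data.Fin using (Fin; toℕ)
open import Data.Nat using (ℕ; suc; _≤_; ∣_-_∣)
open import Data.Product using (Σ; ∃-syntax; Σ-syntax; _×_; _,_; proj₁; proj₂)
open import Data.Sum using (_⊎_)
open import Data.Vec using (Vec; []; _∷_; lookup)
open import Function using (Func; Injection)
open import Function.Definitions using (Surjective)
open import Level using (Level; _⊔_; 0ℓ) renaming (suc to lsuc)
open import Relation.Binary using (Rel; Setoid; _Respects_)
open import Relation.Binary.PropositionalEquality using (_≡_; _≢_; refl; sym; trans; subst)
import Relation.Binary.PropositionalEquality as ≡
import Relation.Binary.Construct.On as On
open import Relation.Unary
  using (Pred; ∅; _∈_; _≐_; _⊥_; Empty; Universal; Satisfiable; ⋃)
open import Relation.Unary.Properties using (≐-refl; ≐-sym; ≐-trans)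
open import Relation.Unary.Relation.Binary.Equality using (≐-setoid)

private
  variable
    a b c ℓ ℓ′ r r′ : Level

-- The total space of an ℕ-indexed family of setoids: elements are equal when
-- they have the same index and are equal there.

module _ (S : ℕ → Setoid c ℓ) where
  private
    open module S k = Setoid (S k) using (Carrier)

  Graded : Rel (Σ ℕ Carrier) ℓ
  Graded (j , x) (k , y) =
    Σ[ j≡k ∈ j ≡ k ] Setoid._≈_ (S k) (subst Carrier j≡k x) y

  gradedSetoid : Setoid c ℓ
  gradedSetoid = record
    { Carrier       = Σ ℕ Carrier
    ; _≈_           = Graded
    ; isEquivalence = record
      { refl  = refl , S.refl _
      ; sym   = λ { (refl , p) → refl , S.sym _ p }
      ; trans = λ { (refl , p) (refl , q) → refl , S.trans _ p q }
      }
    }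

-- A subset of a setoid, as a setoid of its own; membership proofs are not
-- compared.

subsetoid : (S : Setoid c ℓ) → Pred (Setoid.Carrier S) r → Setoid (c ⊔ r) ℓ
subsetoid S P = On.setoid S (proj₁ {B = P})

Countable : (S : Setoid c ℓ) → Pred (Setoid.Carrier S) r → Set _
Countable S P = Injection (subsetoid S P) (≡.setoid ℕ)

-- Relations over A are compared as sets of tuples.

relationSetoid : Set a → (ℓ : Level) → Setoid _ _
relationSetoid A ℓ = gradedSetoid (λ k → ≐-setoid (Vec A k) ℓ)

FinitaryRelation : Set a → (ℓ : Level) → Set _
FinitaryRelation A ℓ = Setoid.Carrier (relationSetoid A ℓ)

arity : {A : Set a} → FinitaryRelation A ℓ → ℕ
arity = proj₁

record PartialFunction (A : Set a) (ℓ : Level) (m : ℕ) : Set (a ⊔ lsuc ℓ) where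
  field
    domain     : Pred (Vec A m) ℓ
    apply      : ∀ v → v ∈ domain → A
    irrelevant : ∀ v (p q : v ∈ domain) → apply v p ≡ apply v q

partialFunctionSetoid : Set a → (ℓ : Level) → ℕ → Setoid _ _
partialFunctionSetoid A ℓ m = record
  { Carrier       = PartialFunction A ℓ m
  ; _≈_           = λ f g → domain f ≐ domain g ×
                            (∀ v p q → apply f v p ≡ apply g v q)
  ; isEquivalence = record
    { refl  = λ {f} → ≐-refl , irrelevant f
    ; sym   = λ (d , e) → ≐-sym d , λ v p q → sym (e v q p)
    ; trans = λ (d , e) (d′ , e′) → ≐-trans d d′ ,
                λ v p q → trans (e v p (proj₁ d p)) (e′ v (proj₁ d p) q)
    }
  }
  where open PartialFunction

functionSetoid : Set a → (ℓ : Level) → Setoid _ _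
functionSetoid A ℓ = gradedSetoid (partialFunctionSetoid A ℓ)

record Architecture (a ℓ r : Level) : Set (lsuc (a ⊔ ℓ ⊔ r)) where
  field
    Universe : Set a

  private
    module Rels = Setoid (relationSetoid Universe ℓ)
    module Funs = Setoid (functionSetoid Universe ℓ)

  field
    Relations           : Pred Rels.Carrier r
    Relations-resp      : Relations Respects Rels._≈_
    Relations-countable : Countable (relationSetoid Universe ℓ) Relations
    Functions           : Pred Funs.Carrier r
    Functions-resp      : Functions Respects Funs._≈_
    Functions-countable : Countable (functionSetoid Universe ℓ) Functions

record BCArchitecture (a ℓ r : Level) : Set (lsuc (a ⊔ ℓ ⊔ r)) where
  field
    architecture : Architecture a ℓ r

  open Architecture architecture public

  field
    binary      : ∀ R → R ∈ Relations → arity R ≡ 2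
    noFunctions : Empty Functions

  -- By `binary`, these are all the relations of the architecture.
  BinaryRelations : Pred (Pred (Vec Universe 2) ℓ) r
  BinaryRelations R = (2 , R) ∈ Relations

  binaryRelationSetoid : Setoid _ _
  binaryRelationSetoid = subsetoid (≐-setoid (Vec Universe 2) ℓ) BinaryRelations

record IsPartition {A : Set a} {n : ℕ} (C : Fin n → Pred A ℓ) : Set (a ⊔ ℓ) where
  field
    nonempty : ∀ i → Satisfiable (C i)
    disjoint : ∀ i j → i ≢ j → C i ⊥ C j
    covers   : Universal (⋃ (Fin n) C)

-- Tiers are numbered from 0, and (l , l′) runs over the pairs of consecutive
-- tiers; there are none when n ≤ 1.

IsTiering : (𝒜 : Architecture a ℓ r) {n : ℕ} →
            (Fin n → Pred (Architecture.Universe 𝒜) ℓ) → Set _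
IsTiering 𝒜 {n} C =
  ∀ k R → (k , R) ∈ Relations → ∀ v → v ∈ R →
  ∃[ l ] ∃[ l′ ] toℕ l′ ≡ suc (toℕ l) ×
    (∀ (j : Fin k) → lookup v j ∈ C l ⊎ lookup v j ∈ C l′)
  where open Architecture 𝒜

IsNTier : ℕ → Architecture a ℓ r → Set _
IsNTier {ℓ = ℓ} n 𝒜 =
  Σ[ C ∈ (Fin n → Pred (Architecture.Universe 𝒜) ℓ) ]
    IsPartition C × IsTiering 𝒜 C

-- The shift from {1,…,n} to Fin n leaves |i − j| unchanged.

Tᴸ : (n : ℕ) → Pred (Vec (Fin n) 2) 0ℓ
Tᴸ n (i ∷ j ∷ []) = ∣ toℕ i - toℕ j ∣ ≤ 1

elementary : ℕ → BCArchitecture 0ℓ 0ℓ 0ℓ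
elementary n = record
  { architecture = record
    { Universe            = Fin n
    ; Relations           = λ R → R Rels.≈ (2 , Tᴸ n)
    ; Relations-resp      = λ R≈S R≈T → Rels.trans (Rels.sym R≈S) R≈T
    ; Relations-countable = record
      { to        = λ _ → 0
      ; cong      = λ _ → refl
      ; injective = λ { {_ , R≈T} {_ , S≈T} _ → Rels.trans R≈T (Rels.sym S≈T) }
      }
    ; Functions           = ∅
    ; Functions-resp      = λ _ ()
    ; Functions-countable = record
      { to        = λ _ → 0
      ; cong      = λ _ → refl
      ; injective = λ { {_ , ()} }
      }
    }
  ; binary      = λ _ → proj₁
  ; noFunctions = λ _ ()
  }
  where module Rels = Setoid (relationSetoid (Fin n) 0ℓ)

-- There is no map between the sets of functions, as both are empty.

record Homomorphism (𝒜 : BCArchitecture a ℓ r) (ℬ : BCArchitecture b ℓ′ r′) :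
       Set (a ⊔ b ⊔ lsuc ℓ ⊔ lsuc ℓ′ ⊔ r ⊔ r′) where
  private
    module 𝒜 = BCArchitecture 𝒜
    module ℬ = BCArchitecture ℬ
  field
    h₀        : 𝒜.Universe → ℬ.Universe
    hᴿ        : Func 𝒜.binaryRelationSetoid ℬ.binaryRelationSetoid
    preserves : ∀ R a₁ a₂ → (a₁ ∷ a₂ ∷ []) ∈ proj₁ R →
                (h₀ a₁ ∷ h₀ a₂ ∷ []) ∈ proj₁ (Func.to hᴿ R)

IsSurjective : {𝒜 : BCArchitecture a ℓ r} {ℬ : BCArchitecture b ℓ′ r′} →
               Homomorphism 𝒜 ℬ → Set _
IsSurjective {𝒜 = 𝒜} {ℬ = ℬ} h =
  Surjective _≡_ _≡_ h₀ ×
  Surjective (Setoid._≈_ (BCArchitecture.binaryRelationSetoid 𝒜))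
             (Setoid._≈_ (BCArchitecture.binaryRelationSetoid ℬ))
             (Func.to hᴿ)
  where open Homomorphism h

SurjectiveHomomorphism : BCArchitecture a ℓ r → BCArchitecture b ℓ′ r′ → Set _
SurjectiveHomomorphism 𝒜 ℬ = Σ (Homomorphism 𝒜 ℬ) IsSurjective

IsNTierBC : ℕ → BCArchitecture a ℓ r → Set _
IsNTierBC n 𝒜 = IsNTier n (BCArchitecture.architecture 𝒜)

{-# OPTIONS --safe #-}
module Submission where

-- The tiers of 𝒜 are the fibres of h₀. The hypothesis that 𝒜 has a relation
-- makes hᴿ surjective, and 2 ≤ n provides a neighbouring tier for a relation
-- that stays inside a single one.

open import Defs
open import Data.Nat using (ℕ; NonZero; _≤_)
open import Data.Product using (_×_)
open import Relation.Unary using (Satisfiable)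

open import Data.Fin using (Fin; zero; suc; toℕ)
open import Data.Fin.Properties using (_≟_)
open import Data.Nat using (z≤n; s≤s; ∣_-_∣)
open import Data.Nat.Properties using (∣n-n∣≡0; ∣-∣-comm)
open import Data.Product using (_,_; proj₁; proj₂; ∃-syntax)
open import Data.Sum using (_⊎_; inj₁; inj₂)
import Data.Sum as Sum
open import Data.Vec using ([]; _∷_)
open import Function using (Func)
open import Level using (Lift; lift)
open import Relation.Binary using (Setoid)
open import Relation.Binary.PropositionalEquality using (_≡_; refl; sym; trans; cong; subst)
open import Relation.Nullary.Decidable using (decidable-stable)
open import Relation.Unary using (Pred; _∈_; _≐_)
open import Relation.Unary.Properties using (≐-refl)

-- A partition of the universe into `n` nonempty classes is the same data as a surjection onto
-- `Fin n`: each element goes to the index of its class, and the classes are the fibres. Under this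
-- correspondence the tier condition on a related pair says that both indices lie in some
-- `{l, l + 1}`, which for `2 ≤ n` is equivalent to their differing by at most 1
-- (`InConsecutive⇒Tᴸ`, `Tᴸ⇒InConsecutive`). On relations the map is constant, since `Tᴸ n` is the
-- only target up to `≐`.

∣n-1+n∣≤1 : ∀ n → ∣ n - ℕ.suc n ∣ ≤ 1
∣n-1+n∣≤1 ℕ.zero    = s≤s z≤n
∣n-1+n∣≤1 (ℕ.suc n) = ∣n-1+n∣≤1 n

∣n-n∣≤1 : ∀ n → ∣ n - n ∣ ≤ 1
∣n-n∣≤1 n = subst (_≤ 1) (sym (∣n-n∣≡0 n)) z≤n

-- The condition of `IsTiering` on a related pair, read on the tier indices of its two components.
InConsecutive : ∀ {n} → Fin n → Fin n → Set
InConsecutive i j = ∃[ l ] ∃[ l′ ] toℕ l′ ≡ ℕ.suc (toℕ l) ×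
  (i ≡ l ⊎ i ≡ l′) × (j ≡ l ⊎ j ≡ l′)

InConsecutive⇒Tᴸ : ∀ {n} {i j : Fin n} → InConsecutive i j → (i ∷ j ∷ []) ∈ Tᴸ n
InConsecutive⇒Tᴸ (l , _  , _  , inj₁ refl , inj₁ refl) = ∣n-n∣≤1 (toℕ l)
InConsecutive⇒Tᴸ (_ , l′ , _  , inj₂ refl , inj₂ refl) = ∣n-n∣≤1 (toℕ l′)
InConsecutive⇒Tᴸ (l , _  , eq , inj₁ refl , inj₂ refl) rewrite eq = ∣n-1+n∣≤1 (toℕ l)
InConsecutive⇒Tᴸ (l , _  , eq , inj₂ refl , inj₁ refl) rewrite eq =
  subst (_≤ 1) (∣-∣-comm (toℕ l) (ℕ.suc (toℕ l))) (∣n-1+n∣≤1 (toℕ l))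

-- Both indices are lowered together until they lie in the lowest two tiers, which exist by `2 ≤ n`.
Tᴸ⇒InConsecutive : ∀ {n} → 2 ≤ n → (i j : Fin n) → (i ∷ j ∷ []) ∈ Tᴸ n → InConsecutive i j
Tᴸ⇒InConsecutive (s≤s (s≤s _)) zero          zero          _ =
  zero , suc zero , refl , inj₁ refl , inj₁ refl
Tᴸ⇒InConsecutive (s≤s (s≤s _)) zero          (suc zero)    _ =
  zero , suc zero , refl , inj₁ refl , inj₂ refl
Tᴸ⇒InConsecutive (s≤s (s≤s _)) (suc zero)    zero          _ =
  zero , suc zero , refl , inj₂ refl , inj₁ refl
-- Not left to the recursion: for `n = 2` it would land in `Fin 1`, which has no consecutive pair.
Tᴸ⇒InConsecutive (s≤s (s≤s _)) (suc zero)    (suc zero)    _ =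
  zero , suc zero , refl , inj₂ refl , inj₂ refl
Tᴸ⇒InConsecutive _             zero          (suc (suc _)) (s≤s ())
Tᴸ⇒InConsecutive _             (suc (suc _)) zero          (s≤s ())
Tᴸ⇒InConsecutive {ℕ.suc (ℕ.suc (ℕ.suc _))} _ (suc i) (suc j) i~j
  with l , l′ , eq , i∈ , j∈ ← Tᴸ⇒InConsecutive (s≤s (s≤s z≤n)) i j i~j =
  suc l , suc l′ , cong ℕ.suc eq ,
  Sum.map (cong suc) (cong suc) i∈ , Sum.map (cong suc) (cong suc) j∈

elementary-relation : ∀ {n} (R : Setoid.Carrier (BCArchitecture.binaryRelationSetoid (elementary n))) →
                      proj₁ R ≐ Tᴸ n
elementary-relation (_ , refl , R≐Tᴸ) = R≐Tᴸ

module _ {a ℓ r} {n : ℕ} (𝒜 : BCArchitecture a ℓ r) where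
  open BCArchitecture 𝒜

  nTier⇒surjection : Satisfiable Relations → IsNTierBC n 𝒜 →
                     SurjectiveHomomorphism 𝒜 (elementary n)
  nTier⇒surjection (R₀ , R₀∈) (C , partition , tiering) with refl ← binary R₀ R₀∈ =
    record
      { h₀        = tier
      ; hᴿ        = record { to = λ _ → Tᴸ n , refl , ≐-refl ; cong = λ _ → ≐-refl }
      ; preserves = tier-preserves
      } ,
    (λ i → proj₁ (nonempty i) , λ { refl → tier-unique (proj₂ (nonempty i)) }) ,
    -- Every relation of `elementary n` is `Tᴸ n` up to `≐`, so `R₀` is a preimage of each.
    (λ S → (proj₂ R₀ , R₀∈) , λ _ → let S⊆Tᴸ , Tᴸ⊆S = elementary-relation S in Tᴸ⊆S , S⊆Tᴸ)
    where
    open IsPartition partition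

    tier : Universe → Fin n
    tier x = proj₁ (covers x)

    -- Disjointness only refutes `tier x ≢ i`; decidable equality on `Fin n` removes the double
    -- negation.
    tier-unique : ∀ {x i} → x ∈ C i → tier x ≡ i
    tier-unique {x} {i} x∈Cᵢ = decidable-stable (tier x ≟ i)
      λ tier≢i → disjoint (tier x) i tier≢i (proj₂ (covers x) , x∈Cᵢ)

    tier-preserves : ∀ (R : Setoid.Carrier binaryRelationSetoid) x y →
                     (x ∷ y ∷ []) ∈ proj₁ R → (tier x ∷ tier y ∷ []) ∈ Tᴸ n
    tier-preserves (R , R∈) x y xRy
      with l , l′ , eq , within ← tiering 2 R R∈ (x ∷ y ∷ []) xRy =
      InConsecutive⇒Tᴸ (l , l′ , eq ,
        Sum.map tier-unique tier-unique (within zero) ,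
        Sum.map tier-unique tier-unique (within (suc zero)))

  surjection⇒nTier : 2 ≤ n → SurjectiveHomomorphism 𝒜 (elementary n) → IsNTierBC n 𝒜
  surjection⇒nTier 2≤n (h , h₀-surjective , _) =
    fibre ,
    record
      { nonempty = λ i → let x , hx≡i = h₀-surjective i in x , lift (hx≡i refl)
      ; disjoint = λ { _ _ i≢j (lift hx≡i , lift hx≡j) → i≢j (trans (sym hx≡i) hx≡j) }
      ; covers   = λ x → h₀ x , lift refl
      } ,
    fibre-tiering
    where
    open Homomorphism h

    -- `Lift` raises the equality to level `ℓ`, where `IsNTier` requires tiers to live.
    fibre : Fin n → Pred Universe ℓ
    fibre i x = Lift ℓ (h₀ x ≡ i)

    fibre-tiering : IsTiering architecture fibre
    fibre-tiering k R R∈ v v∈R with refl ← binary (k , R) R∈ | x ∷ y ∷ [] ← v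
      -- The image of `R` under `hᴿ` can only be `Tᴸ n`, so `h₀ x` and `h₀ y` differ by at most 1.
      with l , l′ , eq , x∈ , y∈ ← Tᴸ⇒InConsecutive 2≤n (h₀ x) (h₀ y)
             (proj₁ (elementary-relation (Func.to hᴿ (R , R∈)))
               (preserves (R , R∈) x y v∈R)) =
      l , l′ , eq , λ where
        zero       → Sum.map lift lift x∈
        (suc zero) → Sum.map lift lift y∈

theorem2 : ∀ {a ℓ r} (n : ℕ) .{{_ : NonZero n}} (𝒜 : BCArchitecture a ℓ r) →
    (Satisfiable (BCArchitecture.Relations 𝒜) →
    IsNTierBC n 𝒜 → SurjectiveHomomorphism 𝒜 (elementary n)) ×
    (2 ≤ n →
    SurjectiveHomomorphism 𝒜 (elementary n) → IsNTierBC n 𝒜)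
theorem2 n 𝒜 = nTier⇒surjection 𝒜 , surjection⇒nTier 𝒜
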